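{- Let $S$ be a finite GCD closed set of distinct positive integers. If the element $x_i\in S$ generates a double-chain set in $S$ (with respect to the divisibility order), then $\Psi_{S,\frac1N}(x_i)\neq0$.
   Context: $S$ is GCD closed if $\gcd(x,y)\in S$ for all $x,y\in S$; then $(S,\mid)$ is a meet semilattice with meet $\gcd$. $C_S(x)$ is the set of elements of $S$ covered by $x$ in $(S,\mid)$ (proper divisors $y\in S$ of $x$ with no $z\in S$, $z\ne y,x$, with $y\mid z\mid x$). $\mathrm{meetcl}(C)$ is the set of all gcd's of nonempty finite subsets of $C$. $x\in S$ generates a double-chain set in $S$ if $\mathrm{meetcl}(C_S(x))\setminus C_S(x)$ is a union of two disjoint (possibly empty) chains under divisibility. $\mu_S$ is the Möbius function of $(S,\mid)$, and $\Psi_{S,\frac1N}(x_i)=\sum_{x_j\in S,\ x_j\mid x_i}\mu_S(x_j,x_i)/x_j$. -}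

module Defs where

open import Data.Nat as ℕ using (ℕ; zero; suc; _<_)
open import Data.Nat.Divisibility using (_∣_; _∣?_)
open import Data.Nat.GCD using (gcd)
open import Data.Integer as ℤ using (ℤ)
open import Data.Rational as ℚ using (ℚ; 0ℚ)
open import Data.List using (List; []; _∷_; filter; map)
open import Data.List.NonEmpty using (List⁺; foldr₁; toList)
open import Data.List.Membership.Propositional using (_∈_)
open import Data.List.Relation.Unary.All using (All)
open import Data.List.Relation.Unary.Unique.Propositional using (Unique)
open import Data.Product using (Σ; _×_; ∃-syntax)
open import Data.Sum using (_⊎_)
open import Data.Empty using (⊥)
open import Relation.Nullary using (¬_; yes; no)
open import Relation.Nullary.Decidable using (_×-dec_; ¬?)
open import Relation.Binary.PropositionalEquality using (_≡_)
open import Function.Bundles using (_⇔_)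

record FinPosSet (S : List ℕ) : Set where
  field
    distinct : Unique S
    positive : All (λ x → 0 < x) S

GCDClosed : List ℕ → Set
GCDClosed S = ∀ {x y} → x ∈ S → y ∈ S → gcd x y ∈ S

sumℤ : List ℤ → ℤ
sumℤ [] = ℤ.0ℤ
sumℤ (a ∷ as) = a ℤ.+ sumℤ as

sumℚ : List ℚ → ℚ
sumℚ [] = 0ℚ
sumℚ (a ∷ as) = a ℚ.+ sumℚ as

-- Möbius function of (S, ∣), by the standard recursion
--   μ(y,x) = 1 if y = x,  μ(y,x) = - Σ_{z ∈ S, y ∣ z ∣ x, z ≠ x} μ(y,z) otherwise
-- (which is 0 when y ∤ x). The first argument is fuel; since all elements of S are
-- positive, z ∣ x with z ≠ x forces z < x, so fuel x suffices for target x.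
mobiusF : ℕ → List ℕ → ℕ → ℕ → ℤ
mobiusF fuel S y x with y ℕ.≟ x
... | yes _ = ℤ.1ℤ
mobiusF zero S y x | no _ = ℤ.0ℤ
mobiusF (suc k) S y x | no _ =
  ℤ.- sumℤ (map (λ z → mobiusF k S y z)
                (filter (λ z → (y ∣? z) ×-dec ((z ∣? x) ×-dec ¬? (z ℕ.≟ x))) S))

μ : List ℕ → ℕ → ℕ → ℤ
μ S y x = mobiusF x S y x

-- 1/n as a rational (n ≥ 1 for all elements of S; the value at 0 is irrelevant).
recip : ℕ → ℚ
recip zero = 0ℚ
recip (suc n) = ℤ.+ 1 ℚ./ suc n

Ψ : List ℕ → ℕ → ℚ
Ψ S x = sumℚ (map (λ y → (μ S y x ℚ./ 1) ℚ.* recip y) (filter (_∣? x) S))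

Covered : List ℕ → ℕ → ℕ → Set
Covered S x y = y ∈ S × y ∣ x × ¬ (y ≡ x)
              × (∀ z → z ∈ S → y ∣ z → z ∣ x → z ≡ y ⊎ z ≡ x)

gcd⁺ : List⁺ ℕ → ℕ
gcd⁺ = foldr₁ gcd

InMeetClCover : List ℕ → ℕ → ℕ → Set
InMeetClCover S x m =
  Σ (List⁺ ℕ) λ L → All (Covered S x) (toList L) × gcd⁺ L ≡ m

IsChain : List ℕ → Set
IsChain A = ∀ {a b} → a ∈ A → b ∈ A → a ∣ b ⊎ b ∣ a

DoubleChain : List ℕ → ℕ → Set
DoubleChain S x =
  ∃[ A ] ∃[ B ] IsChain A × IsChain B
    × (∀ {m} → m ∈ A → m ∈ B → ⊥)
    × (∀ m → (InMeetClCover S x m × ¬ Covered S x m) ⇔ (m ∈ A ⊎ m ∈ B))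

{-# OPTIONS --safe #-}
-- By Möbius inversion 1/g is the sum of Ψ(z) over the z ∈ S dividing g. For a list cs of elements
-- covered by x, let T(x, cs) be the sum of Ψ(z) over the z ∣ x dividing no member of cs; it equals
-- 1/x for the empty list and Ψ(x) for the list of all covered elements.
-- T(x, {c}) = 1/x − 1/c < 0, and T(x, cs) > 0 for every list cs of at least two covered elements:
--   * T(x, {c, d}) = 1/x − 1/c − 1/d + 1/gcd(c,d) > 0, as gcd(c,d) is a proper divisor of c and of d;
--   * T(x, cs ∪ {c}) = T(x, cs) − T(c, cs), and T(c, cs) = 1/c − 1/e < 0 whenever one of the
--     gcd(c, d), d ∈ cs, call it e, is divisible by all the others.
-- A c of the latter kind always exists when the gcds are covered by two chains A and B: choose c
-- with the fewest divisors in A. Then a gcd(c, d) in A divides all elements, hence all gcds, and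
-- the remaining ones lie in the chain B.
module Submission where

open import Defs
open import Data.Nat as ℕ using (ℕ; zero; suc; _<_; _≤_)
import Data.Nat.Properties as ℕ
open import Data.Nat.Solver using (module +-*-Solver)
open import Data.Nat.Divisibility
  using (_∣_; _∣?_; ∣⇒≤; ∣-refl; ∣-trans; ∣-antisym; quotient; quotient>1; m∣n⇒n≡m*quotient)
open import Data.Nat.GCD using (gcd; gcd[m,n]∣m; gcd[m,n]∣n; gcd-greatest; gcd-comm)
open import Data.Integer as ℤ using (ℤ)
import Data.Integer.Properties as ℤ
open import Data.Rational.Solver renaming (module +-*-Solver to ℚ-Solver)
open import Data.Rational as ℚ using (ℚ; 0ℚ; 1ℚ; _+_; _*_; -_)
import Data.Rational.Properties as ℚ
import Data.Rational.Unnormalised as ℚᵘ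
import Data.Rational.Unnormalised.Properties as ℚᵘ
open import Data.List using (List; []; _∷_; _++_; filter; map; length)
open import Data.List.NonEmpty using (_∷_)
open import Data.List.Properties using (map-cong-local)
open import Data.List.Membership.Propositional using (_∈_; find; lose)
open import Data.List.Membership.Propositional.Properties
  using (∈-filter⁺; ∈-filter⁻; ∈-∃++)
open import Data.List.Relation.Unary.All as All using (All; []; _∷_)
open import Data.List.Relation.Unary.Any as Any using (Any; any?; here; there)
open import Data.List.Relation.Unary.AllPairs using ([]; _∷_)
open import Data.List.Relation.Unary.Unique.Propositional using (Unique)
open import Data.List.Relation.Unary.Unique.Propositional.Properties using (filter⁺)
open import Data.List.Relation.Binary.Permutation.Propositional using (_↭_; ↭-sym; ↭⇒↭ₛ)
open import Data.List.Relation.Binary.Permutation.Propositional.Properties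
  using (∈-resp-↭; Any-resp-↭; shift; ↭-length)
open import Data.List.Relation.Binary.Permutation.Setoid.Properties using (Unique-resp-↭)
open import Data.Product using (_×_; _,_; proj₁; ∃-syntax)
open import Data.Sum using (_⊎_; inj₁; inj₂)
open import Function using (_∘_)
open import Function.Bundles using (Equivalence)
open import Level using (0ℓ)
open import Relation.Nullary using (¬_; Dec; yes; no; contradiction)
open import Relation.Nullary.Decidable using (_×-dec_; ¬?)
open import Relation.Unary using (Pred; Decidable)
open import Relation.Binary.PropositionalEquality
  using (_≡_; _≢_; refl; sym; trans; cong; cong₂; subst; setoid; module ≡-Reasoning)
open import Algebra.Bundles using (CommutativeMonoid)
open import Algebra.Properties.CommutativeSemigroup
  (CommutativeMonoid.commutativeSemigroup ℚ.+-0-commutativeMonoid) using (interchange)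

private
  variable
    P Q R X Y : Set
    A B S : List ℕ

-- Finite sums and indicators

∑ : List X → (X → ℚ) → ℚ
∑ S f = sumℚ (map f S)

on : Dec P → ℚ → ℚ
on (yes _) q = q
on (no _)  q = 0ℚ

on-yes : (d : Dec P) → P → ∀ {q} → on d q ≡ q
on-yes (yes _) p = refl
on-yes (no ¬p) p = contradiction p ¬p

on-no : (d : Dec P) → ¬ P → ∀ {q} → on d q ≡ 0ℚ
on-no (yes p) ¬p = contradiction p ¬p
on-no (no _)  ¬p = refl

on-cong : (d : Dec P) (e : Dec Q) → (P → Q) → (Q → P) → ∀ {q r} → (P → q ≡ r) → on d q ≡ on e r
on-cong (yes p) e f g q≡r = trans (q≡r p) (sym (on-yes e (f p)))
on-cong (no ¬p) e f g q≡r = sym (on-no e (¬p ∘ g))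

on-* : (d : Dec P) → ∀ q r → on d (q * r) ≡ on d q * r
on-* (yes _) q r = refl
on-* (no _)  q r = sym (ℚ.*-zeroˡ r)

on-on : (d : Dec P) (e : Dec Q) → ∀ {q} → on d (on e q) ≡ on (e ×-dec d) q
on-on (yes _) (yes _) = refl
on-on (yes _) (no _)  = refl
on-on (no _)  (yes _) = refl
on-on (no _)  (no _)  = refl

on-split : (d : Dec P) (e : Dec Q) (f : Dec R) → (P → Q ⊎ R) → (Q → P) → (R → P) → (Q → ¬ R) →
  ∀ {q} → on d q ≡ on e q + on f q
on-split d (yes q) (yes r) _ _ _ disjoint = contradiction r (disjoint q)
on-split d (yes q) (no _)  _ g _ _ = trans (on-yes d (g q)) (sym (ℚ.+-identityʳ _))
on-split d (no _)  (yes r) _ _ h _ = trans (on-yes d (h r)) (sym (ℚ.+-identityˡ _))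
on-split d (no ¬q) (no ¬r) f _ _ _ = trans (on-no d ¬p) (sym (ℚ.+-identityˡ _))
  where
  ¬p : ¬ _
  ¬p p with f p
  ... | inj₁ q = ¬q q
  ... | inj₂ r = ¬r r

∑-cong : (S : List X) {f g : X → ℚ} → (∀ {z} → z ∈ S → f z ≡ g z) → ∑ S f ≡ ∑ S g
∑-cong S f≡g = cong sumℚ (map-cong-local (All.tabulate f≡g))

∑-zero : (S : List X) → ∑ S (λ _ → 0ℚ) ≡ 0ℚ
∑-zero []      = refl
∑-zero (_ ∷ S) = trans (ℚ.+-identityˡ _) (∑-zero S)

∑-+ : (S : List X) (f g : X → ℚ) → ∑ S (λ z → f z + g z) ≡ ∑ S f + ∑ S g
∑-+ []      f g = refl
∑-+ (z ∷ S) f g = trans (cong (f z + g z +_) (∑-+ S f g)) (interchange (f z) (g z) (∑ S f) (∑ S g))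

∑-*ʳ : (S : List X) (f : X → ℚ) (r : ℚ) → ∑ S (λ z → f z * r) ≡ ∑ S f * r
∑-*ʳ []      f r = sym (ℚ.*-zeroˡ r)
∑-*ʳ (z ∷ S) f r = trans (cong (f z * r +_) (∑-*ʳ S f r)) (sym (ℚ.*-distribʳ-+ r (f z) (∑ S f)))

∑-on : (S : List X) (f : X → ℚ) (d : Dec P) → on d (∑ S f) ≡ ∑ S (λ z → on d (f z))
∑-on S f (yes _) = refl
∑-on S f (no _)  = sym (∑-zero S)

∑-swap : (S : List X) (U : List Y) (f : X → Y → ℚ) →
  ∑ S (λ z → ∑ U (f z)) ≡ ∑ U (λ y → ∑ S (λ z → f z y))
∑-swap []      U f = sym (∑-zero U)
∑-swap (z ∷ S) U f =
  trans (cong (∑ U (f z) +_) (∑-swap S U f)) (sym (∑-+ U (f z) (λ y → ∑ S (λ z → f z y))))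

∑-filter : {P : Pred X 0ℓ} (P? : Decidable P) (S : List X) (f : X → ℚ) →
  ∑ (filter P? S) f ≡ ∑ S (λ z → on (P? z) (f z))
∑-filter P? []      f = refl
∑-filter P? (z ∷ S) f with P? z
... | yes _ = cong (f z +_) (∑-filter P? S f)
... | no _  = trans (∑-filter P? S f) (sym (ℚ.+-identityˡ _))

∑-single : Unique S → ∀ {x} → x ∈ S → (f : ℕ → ℚ) → ∑ S (λ z → on (z ℕ.≟ x) (f z)) ≡ f x
∑-single {S = z ∷ S} (z∉S ∷ _) (here refl) f = begin
  on (z ℕ.≟ z) (f z) + ∑ S (λ y → on (y ℕ.≟ z) (f y))
    ≡⟨ cong₂ _+_ (on-yes (z ℕ.≟ z) refl)
         (∑-cong S λ y∈S → on-no (_ ℕ.≟ z) (All.lookup z∉S y∈S ∘ sym)) ⟩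
  f z + ∑ S (λ _ → 0ℚ)  ≡⟨ cong (f z +_) (∑-zero S) ⟩
  f z + 0ℚ              ≡⟨ ℚ.+-identityʳ (f z) ⟩
  f z                   ∎
  where open ≡-Reasoning
∑-single {S = z ∷ S} (z∉S ∷ uniq) {x} (there x∈S) f =
  trans (cong₂ _+_ (on-no (z ℕ.≟ x) (All.lookup z∉S x∈S)) (∑-single uniq x∈S f)) (ℚ.+-identityˡ _)

-- Integers and reciprocals in ℚ

-- Leads from a normalised fraction to an unnormalised one, where sums and inequalities are computed
-- on numerators and denominators without the reduction to lowest terms.
toℚᵘ-/ : ∀ i n → ℚ.toℚᵘ (i ℚ./ suc n) ℚᵘ.≃ ℚᵘ.mkℚᵘ i n
toℚᵘ-/ i n = ℚ.toℚᵘ-fromℚᵘ (ℚᵘ.mkℚᵘ i n)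

/1-homo-+ : ∀ i j → (i ℤ.+ j) ℚ./ 1 ≡ i ℚ./ 1 + j ℚ./ 1
/1-homo-+ i j = ℚ.toℚᵘ-injective (begin-equality
  ℚ.toℚᵘ ((i ℤ.+ j) ℚ./ 1)                   ≃⟨ toℚᵘ-/ (i ℤ.+ j) 0 ⟩
  ℚᵘ.mkℚᵘ (i ℤ.+ j) 0
    ≡⟨ cong (λ k → ℚᵘ.mkℚᵘ k 0) (cong₂ ℤ._+_ (ℤ.*-identityʳ i) (ℤ.*-identityʳ j)) ⟨
  ℚᵘ.mkℚᵘ i 0 ℚᵘ.+ ℚᵘ.mkℚᵘ j 0               ≃⟨ ℚᵘ.+-cong (toℚᵘ-/ i 0) (toℚᵘ-/ j 0) ⟨
  ℚ.toℚᵘ (i ℚ./ 1) ℚᵘ.+ ℚ.toℚᵘ (j ℚ./ 1)     ≃⟨ ℚ.toℚᵘ-homo-+ (i ℚ./ 1) (j ℚ./ 1) ⟨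
  ℚ.toℚᵘ (i ℚ./ 1 + j ℚ./ 1)                 ∎)
  where open ℚᵘ.≤-Reasoning

/1-homo-‿- : ∀ i → (ℤ.- i) ℚ./ 1 ≡ - (i ℚ./ 1)
/1-homo-‿- i = ℚ.toℚᵘ-injective (begin-equality
  ℚ.toℚᵘ ((ℤ.- i) ℚ./ 1)     ≃⟨ toℚᵘ-/ (ℤ.- i) 0 ⟩
  ℚᵘ.- ℚᵘ.mkℚᵘ i 0           ≃⟨ ℚᵘ.-‿cong (toℚᵘ-/ i 0) ⟨
  ℚᵘ.- ℚ.toℚᵘ (i ℚ./ 1)      ≃⟨ ℚ.toℚᵘ-homo‿- (i ℚ./ 1) ⟨
  ℚ.toℚᵘ (- (i ℚ./ 1))       ∎)
  where open ℚᵘ.≤-Reasoning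

sumℤ-/1 : (f : X → ℤ) (S : List X) → sumℤ (map f S) ℚ./ 1 ≡ ∑ S (λ z → f z ℚ./ 1)
sumℤ-/1 f []      = refl
sumℤ-/1 f (z ∷ S) = trans (/1-homo-+ (f z) _) (cong (f z ℚ./ 1 +_) (sumℤ-/1 f S))

0<recip : ∀ {n} → 0 < n → 0ℚ ℚ.< recip n
0<recip {suc n} _ = ℚ.positive⁻¹ (recip (suc n)) ⦃ ℚ.normalize-pos 1 (suc n) ⦄

∣∧≢⇒< : ∀ {d n} → 0 < n → d ∣ n → d ≢ n → d < n
∣∧≢⇒< {n = suc _} _ d∣n d≢n = ℕ.≤∧≢⇒< (∣⇒≤ d∣n) d≢n

∣∧<⇒2*≤ : ∀ {d n} → d ∣ n → d < n → d ℕ.* 2 ≤ n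
∣∧<⇒2*≤ {d} {n} d∣n d<n = begin
  d ℕ.* 2              ≤⟨ ℕ.*-monoʳ-≤ d (quotient>1 d∣n d<n) ⟩
  d ℕ.* quotient d∣n   ≡⟨ m∣n⇒n≡m*quotient d∣n ⟨
  n                    ∎
  where open ℕ.≤-Reasoning

recip-double : ∀ {d n} → 0 < d → d ℕ.* 2 ≤ n → recip n + recip n ℚ.≤ recip d
recip-double {suc d} {suc n} _ 2d≤n = ℚ.toℚᵘ-cancel-≤ (let open ℚᵘ.≤-Reasoning in begin
  ℚ.toℚᵘ (recip (suc n) + recip (suc n))
    ≃⟨ ℚ.toℚᵘ-homo-+ (recip (suc n)) (recip (suc n)) ⟩
  ℚ.toℚᵘ (recip (suc n)) ℚᵘ.+ ℚ.toℚᵘ (recip (suc n))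
    ≃⟨ ℚᵘ.+-cong (toℚᵘ-/ (ℤ.+ 1) n) (toℚᵘ-/ (ℤ.+ 1) n) ⟩
  ℚᵘ.mkℚᵘ (ℤ.+ 1) n ℚᵘ.+ ℚᵘ.mkℚᵘ (ℤ.+ 1) n
    ≤⟨ ℚᵘ.*≤* (ℤ.+≤+ cross) ⟩
  ℚᵘ.mkℚᵘ (ℤ.+ 1) d
    ≃⟨ toℚᵘ-/ (ℤ.+ 1) d ⟨
  ℚ.toℚᵘ (recip (suc d)) ∎)
  where
  N = suc n
  cross : (1 ℕ.* N ℕ.+ 1 ℕ.* N) ℕ.* suc d ≤ 1 ℕ.* (N ℕ.* N)
  cross = let open ℕ.≤-Reasoning; open +-*-Solver in begin
    (1 ℕ.* N ℕ.+ 1 ℕ.* N) ℕ.* suc d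
      ≡⟨ solve 2 (λ N D → (con 1 :* N :+ con 1 :* N) :* D := N :* (D :* con 2)) refl N (suc d) ⟩
    N ℕ.* (suc d ℕ.* 2)   ≤⟨ ℕ.*-monoʳ-≤ N 2d≤n ⟩
    N ℕ.* N               ≡⟨ ℕ.*-identityˡ _ ⟨
    1 ℕ.* (N ℕ.* N)       ∎

recip-< : ∀ {d n} → 0 < d → d ∣ n → d < n → recip n ℚ.< recip d
recip-< {d} {n} 0<d d∣n d<n = begin-strict
  recip n             ≡⟨ ℚ.+-identityʳ (recip n) ⟨
  recip n + 0ℚ        <⟨ ℚ.+-monoʳ-< (recip n) (0<recip (ℕ.<-trans 0<d d<n)) ⟩
  recip n + recip n   ≤⟨ recip-double 0<d (∣∧<⇒2*≤ d∣n d<n) ⟩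
  recip d             ∎
  where open ℚ.≤-Reasoning

-- The sum is at most twice the larger reciprocal, and a proper multiple of `e` is at least `2e`, so
-- twice its reciprocal is at most 1/e.
recip-+-≤ : ∀ {e c d} → 0 < e → e ∣ c → e < c → e ∣ d → e < d → recip c + recip d ℚ.≤ recip e
recip-+-≤ {e} {c} {d} 0<e e∣c e<c e∣d e<d with ℚ.≤-total (recip c) (recip d)
... | inj₁ c≤d = ℚ.≤-trans (ℚ.+-monoˡ-≤ (recip d) c≤d) (recip-double 0<e (∣∧<⇒2*≤ e∣d e<d))
... | inj₂ d≤c = ℚ.≤-trans (ℚ.+-monoʳ-≤ (recip c) d≤c) (recip-double 0<e (∣∧<⇒2*≤ e∣c e<c))

+-cancelˡ-< : ∀ r {p q} → r + p ℚ.< r + q → p ℚ.< q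
+-cancelˡ-< r r+p<r+q = ℚ.≰⇒> λ q≤p →
  ℚ.<-irrefl refl (ℚ.<-≤-trans r+p<r+q (ℚ.+-monoʳ-≤ r q≤p))

-- Möbius inversion

-- `μ S y z` starts with fuel `z`, whereas the recursion for `μ S y x` reaches `z` with fuel
-- `x - 1`; this reconciles the two. Each recursive call moves to a proper divisor, which is smaller
-- by positivity, so a sufficient fuel stays sufficient.
mobiusF-fuel : All (0 <_) S → ∀ k l {x} y → 0 < x → x ≤ k → x ≤ l →
  mobiusF k S y x ≡ mobiusF l S y x
mobiusF-fuel pos zero    l       y 0<x x≤0 _ = contradiction (ℕ.<-≤-trans 0<x x≤0) λ ()
mobiusF-fuel pos (suc k) zero    y 0<x _ x≤0 = contradiction (ℕ.<-≤-trans 0<x x≤0) λ ()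
mobiusF-fuel {S} pos (suc k) (suc l) {x} y 0<x x≤k x≤l with y ℕ.≟ x
... | yes _ = refl
... | no _  = cong (ℤ.-_ ∘ sumℤ) (map-cong-local (All.tabulate step))
  where
  step : ∀ {z} → z ∈ filter (λ z → (y ∣? z) ×-dec ((z ∣? x) ×-dec ¬? (z ℕ.≟ x))) S →
    mobiusF k S y z ≡ mobiusF l S y z
  step {z} z∈ with ∈-filter⁻ (λ z → (y ∣? z) ×-dec ((z ∣? x) ×-dec ¬? (z ℕ.≟ x))) {xs = S} z∈
  ... | z∈S , _ , z∣x , z≢x = mobiusF-fuel pos k l y (All.lookup pos z∈S)
      (ℕ.≤-pred (ℕ.≤-trans z<x x≤k)) (ℕ.≤-pred (ℕ.≤-trans z<x x≤l))
    where z<x = ∣∧≢⇒< 0<x z∣x z≢x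

μℚ : List ℕ → ℕ → ℕ → ℚ
μℚ S y z = μ S y z ℚ./ 1

μℚ-refl : ∀ S x → μℚ S x x ≡ 1ℚ
μℚ-refl S x with x ℕ.≟ x
... | yes _  = refl
... | no x≢x = contradiction refl x≢x

μℚ-rec : All (0 <_) S → ∀ {x y} → 0 < x → y ≢ x →
  μℚ S y x ≡ - ∑ S (λ z → on ((y ∣? z) ×-dec ((z ∣? x) ×-dec ¬? (z ℕ.≟ x))) (μℚ S y z))
μℚ-rec {S} pos {suc k} {y} 0<x y≢x with y ℕ.≟ suc k
... | yes y≡x = contradiction y≡x y≢x
... | no _ = begin
  (ℤ.- sumℤ (map (mobiusF k S y) below)) ℚ./ 1     ≡⟨ /1-homo-‿- (sumℤ (map (mobiusF k S y) below)) ⟩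
  - (sumℤ (map (mobiusF k S y) below) ℚ./ 1)       ≡⟨ cong -_ (sumℤ-/1 (mobiusF k S y) below) ⟩
  - ∑ below (λ z → mobiusF k S y z ℚ./ 1)          ≡⟨ cong -_ (∑-cong below fuel) ⟩
  - ∑ below (μℚ S y)                               ≡⟨ cong -_ (∑-filter below? S (μℚ S y)) ⟩
  - ∑ S (λ z → on (below? z) (μℚ S y z))           ∎
  where
  open ≡-Reasoning
  below? : Decidable (λ z → y ∣ z × z ∣ suc k × ¬ z ≡ suc k)
  below? z = (y ∣? z) ×-dec ((z ∣? suc k) ×-dec ¬? (z ℕ.≟ suc k))
  below = filter below? S
  fuel : ∀ {z} → z ∈ below → mobiusF k S y z ℚ./ 1 ≡ μℚ S y z
  fuel {z} z∈ with ∈-filter⁻ below? {xs = S} z∈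
  ... | z∈S , _ , z∣x , z≢x = cong (ℚ._/ 1)
    (mobiusF-fuel pos k z y (All.lookup pos z∈S) (ℕ.≤-pred (∣∧≢⇒< 0<x z∣x z≢x)) ℕ.≤-refl)

-- The recursion defining μ, read as the statement that μ convolved with the zeta function is the
-- identity of the incidence algebra.
∑-μℚ : FinPosSet S → ∀ {x} → x ∈ S → ∀ y →
  ∑ S (λ z → on ((y ∣? z) ×-dec (z ∣? x)) (μℚ S y z)) ≡ on (y ℕ.≟ x) 1ℚ
∑-μℚ {S} fin {x} x∈S y with y ∣? x
... | no y∤x = begin
  ∑ S (λ z → on ((y ∣? z) ×-dec (z ∣? x)) (μℚ S y z))
    ≡⟨ ∑-cong S (λ {z} _ → on-no ((y ∣? z) ×-dec (z ∣? x)) λ { (y∣z , z∣x) → y∤x (∣-trans y∣z z∣x) }) ⟩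
  ∑ S (λ _ → 0ℚ)      ≡⟨ ∑-zero S ⟩
  0ℚ                  ≡⟨ on-no (y ℕ.≟ x) (λ { refl → y∤x ∣-refl }) ⟨
  on (y ℕ.≟ x) 1ℚ     ∎
  where open ≡-Reasoning
... | yes y∣x with y ℕ.≟ x
...   | yes refl = begin
  ∑ S (λ z → on ((x ∣? z) ×-dec (z ∣? x)) (μℚ S x z))
    ≡⟨ ∑-cong S (λ {z} _ → on-cong ((x ∣? z) ×-dec (z ∣? x)) (z ℕ.≟ x)
         (λ { (x∣z , z∣x) → ∣-antisym z∣x x∣z }) (λ { refl → ∣-refl , ∣-refl }) (λ _ → refl)) ⟩
  ∑ S (λ z → on (z ℕ.≟ x) (μℚ S x z))   ≡⟨ ∑-single (FinPosSet.distinct fin) x∈S (μℚ S x) ⟩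
  μℚ S x x                              ≡⟨ μℚ-refl S x ⟩
  1ℚ                                    ∎
  where open ≡-Reasoning
...   | no y≢x = begin
  ∑ S (λ z → on ((y ∣? z) ×-dec (z ∣? x)) (μℚ S y z))
    -- The interval from `y` to `x` is divided into its top element `x` and the rest; by the
    -- recursion the value at `x` is minus the sum over the rest.
    ≡⟨ ∑-cong S (λ {z} _ → on-split ((y ∣? z) ×-dec (z ∣? x)) (z ℕ.≟ x) (below? z)
         split (λ { refl → y∣x , ∣-refl }) (λ { (y∣z , z∣x , _) → y∣z , z∣x })
         (λ { z≡x (_ , _ , z≢x) → z≢x z≡x })) ⟩
  ∑ S (λ z → on (z ℕ.≟ x) (μℚ S y z) + on (below? z) (μℚ S y z))
    ≡⟨ ∑-+ S (λ z → on (z ℕ.≟ x) (μℚ S y z)) (λ z → on (below? z) (μℚ S y z)) ⟩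
  ∑ S (λ z → on (z ℕ.≟ x) (μℚ S y z)) + rest
    ≡⟨ cong (_+ rest) (∑-single (FinPosSet.distinct fin) x∈S (μℚ S y)) ⟩
  μℚ S y x + rest
    ≡⟨ cong (_+ rest) (μℚ-rec pos (All.lookup pos x∈S) y≢x) ⟩
  - rest + rest
    ≡⟨ ℚ.+-inverseˡ rest ⟩
  0ℚ ∎
  where
  open ≡-Reasoning
  pos = FinPosSet.positive fin
  below? : Decidable (λ z → y ∣ z × z ∣ x × ¬ z ≡ x)
  below? z = (y ∣? z) ×-dec ((z ∣? x) ×-dec ¬? (z ℕ.≟ x))
  rest = ∑ S (λ z → on (below? z) (μℚ S y z))
  split : ∀ {z} → y ∣ z × z ∣ x → z ≡ x ⊎ (y ∣ z × z ∣ x × ¬ z ≡ x)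
  split {z} (y∣z , z∣x) with z ℕ.≟ x
  ... | yes z≡x = inj₁ z≡x
  ... | no z≢x  = inj₂ (y∣z , z∣x , z≢x)

-- After unfolding `Ψ` and exchanging the two sums, the inner sum runs over the interval from `y` to
-- `x` and vanishes by `∑-μℚ` unless `y` is `x`.
∑-Ψ : FinPosSet S → ∀ {x} → x ∈ S → ∑ S (λ z → on (z ∣? x) (Ψ S z)) ≡ recip x
∑-Ψ {S} fin {x} x∈S = begin
  ∑ S (λ z → on (z ∣? x) (Ψ S z))
    ≡⟨ ∑-cong S (λ {z} _ → Ψ-summand z) ⟩
  ∑ S (λ z → ∑ S (λ y → on ((y ∣? z) ×-dec (z ∣? x)) (μℚ S y z) * recip y))
    ≡⟨ ∑-swap S S (λ z y → on ((y ∣? z) ×-dec (z ∣? x)) (μℚ S y z) * recip y) ⟩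
  ∑ S (λ y → ∑ S (λ z → on ((y ∣? z) ×-dec (z ∣? x)) (μℚ S y z) * recip y))
    ≡⟨ ∑-cong S (λ {y} _ → trans (∑-*ʳ S (λ z → on ((y ∣? z) ×-dec (z ∣? x)) (μℚ S y z)) (recip y))
         (cong (_* recip y) (∑-μℚ fin x∈S y))) ⟩
  ∑ S (λ y → on (y ℕ.≟ x) 1ℚ * recip y)
    ≡⟨ ∑-cong S (λ {y} _ → trans (sym (on-* (y ℕ.≟ x) 1ℚ (recip y)))
         (cong (on (y ℕ.≟ x)) (ℚ.*-identityˡ (recip y)))) ⟩
  ∑ S (λ y → on (y ℕ.≟ x) (recip y))
    ≡⟨ ∑-single (FinPosSet.distinct fin) x∈S recip ⟩
  recip x ∎
  where
  open ≡-Reasoning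
  Ψ-summand : ∀ z → on (z ∣? x) (Ψ S z)
    ≡ ∑ S (λ y → on ((y ∣? z) ×-dec (z ∣? x)) (μℚ S y z) * recip y)
  Ψ-summand z = begin
    on (z ∣? x) (Ψ S z)
      ≡⟨ cong (on (z ∣? x)) (∑-filter (_∣? z) S (λ y → μℚ S y z * recip y)) ⟩
    on (z ∣? x) (∑ S (λ y → on (y ∣? z) (μℚ S y z * recip y)))
      ≡⟨ ∑-on S (λ y → on (y ∣? z) (μℚ S y z * recip y)) (z ∣? x) ⟩
    ∑ S (λ y → on (z ∣? x) (on (y ∣? z) (μℚ S y z * recip y)))
      ≡⟨ ∑-cong S (λ {y} _ → trans (on-on (z ∣? x) (y ∣? z))
           (on-* ((y ∣? z) ×-dec (z ∣? x)) (μℚ S y z) (recip y))) ⟩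
    ∑ S (λ y → on ((y ∣? z) ×-dec (z ∣? x)) (μℚ S y z) * recip y) ∎

-- Sums of Ψ over the divisors of g that divide no member of cs

Divides∌ : ℕ → List ℕ → ℕ → Set
Divides∌ g cs z = z ∣ g × ¬ Any (z ∣_) cs

divides∌? : ∀ g cs → Decidable (Divides∌ g cs)
divides∌? g cs z = (z ∣? g) ×-dec ¬? (any? (z ∣?_) cs)

T : List ℕ → ℕ → List ℕ → ℚ
T S g cs = ∑ S (λ z → on (divides∌? g cs z) (Ψ S z))

T-cong : ∀ S {g h cs ds} → (∀ {z} → Divides∌ g cs z → Divides∌ h ds z) →
  (∀ {z} → Divides∌ h ds z → Divides∌ g cs z) → T S g cs ≡ T S h ds
T-cong S {g} {h} {cs} {ds} to from =
  ∑-cong S (λ {z} _ → on-cong (divides∌? g cs z) (divides∌? h ds z) to from (λ _ → refl))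

T-↭ : ∀ S {g cs ds} → cs ↭ ds → T S g cs ≡ T S g ds
T-↭ S cs↭ds = T-cong S (λ { (z∣g , z∤cs) → z∣g , z∤cs ∘ Any-resp-↭ (↭-sym cs↭ds) })
                       (λ { (z∣g , z∤ds) → z∣g , z∤ds ∘ Any-resp-↭ cs↭ds })

T-[] : FinPosSet S → ∀ {g} → g ∈ S → T S g [] ≡ recip g
T-[] {S} fin {g} g∈S = trans
  (∑-cong S (λ {z} _ → on-cong (divides∌? g [] z) (z ∣? g) proj₁ (λ z∣g → z∣g , λ ()) (λ _ → refl)))
  (∑-Ψ fin g∈S)

-- One step of inclusion-exclusion: the divisors of `g` that avoid `cs` are sorted by whether they
-- divide `c`.
T-split : ∀ S {g c} cs → c ∣ g → T S g cs ≡ T S c cs + T S g (c ∷ cs)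
T-split S {g} {c} cs c∣g = trans
  (∑-cong S (λ {z} _ → on-split (divides∌? g cs z) (divides∌? c cs z) (divides∌? g (c ∷ cs) z)
    split (λ { (z∣c , z∤cs) → ∣-trans z∣c c∣g , z∤cs })
    (λ { (z∣g , z∤) → z∣g , z∤ ∘ there }) (λ { (z∣c , _) (_ , z∤) → z∤ (here z∣c) })))
  (∑-+ S (λ z → on (divides∌? c cs z) (Ψ S z)) (λ z → on (divides∌? g (c ∷ cs) z) (Ψ S z)))
  where
  split : ∀ {z} → Divides∌ g cs z → Divides∌ c cs z ⊎ Divides∌ g (c ∷ cs) z
  split {z} (z∣g , z∤cs) with z ∣? c
  ... | yes z∣c = inj₁ (z∣c , z∤cs)
  ... | no z∤c  = inj₂ (z∣g , λ { (here z∣c) → z∤c z∣c ; (there z∣cs) → z∤cs z∣cs })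

T-singleton : FinPosSet S → ∀ {c e} → c ∈ S → e ∈ S → e ∣ c → recip c ≡ recip e + T S c (e ∷ [])
T-singleton {S} fin {c} {e} c∈S e∈S e∣c = begin
  recip c                          ≡⟨ T-[] fin c∈S ⟨
  T S c []                         ≡⟨ T-split S [] e∣c ⟩
  T S e [] + T S c (e ∷ [])        ≡⟨ cong (_+ T S c (e ∷ [])) (T-[] fin e∈S) ⟩
  recip e + T S c (e ∷ [])         ∎
  where open ≡-Reasoning

-- A divisor of `c` divides `d` exactly when it divides `gcd c d`. Since all these gcds divide
-- `gcd c m`, avoiding `cs` amounts to avoiding that single number.
T-dominated : ∀ S {c m cs} → m ∈ cs → (∀ {d} → d ∈ cs → gcd c d ∣ gcd c m) →
  T S c cs ≡ T S c (gcd c m ∷ [])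
T-dominated S {c} {m} {cs} m∈cs dominated = T-cong S
  (λ { (z∣c , z∤cs) → z∣c , λ { (here z∣e) → z∤cs (lose m∈cs (∣-trans z∣e (gcd[m,n]∣n c m))) } })
  (λ { (z∣c , z∤e) → z∣c , λ z∣cs → let (_ , d∈cs , z∣d) = find z∣cs in
         z∤e (here (∣-trans (gcd-greatest z∣c z∣d) (dominated d∈cs))) })

-- The value is 1/c - 1/e by `T-singleton`, and `e` is smaller than `c`.
T<0 : FinPosSet S → ∀ {c e} → c ∈ S → e ∈ S → e ∣ c → e ≢ c → T S c (e ∷ []) ℚ.< 0ℚ
T<0 {S} fin {c} {e} c∈S e∈S e∣c e≢c = +-cancelˡ-< (recip e) (begin-strict
  recip e + T S c (e ∷ [])   ≡⟨ T-singleton fin c∈S e∈S e∣c ⟨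
  recip c                    <⟨ recip-< (All.lookup pos e∈S) e∣c (∣∧≢⇒< (All.lookup pos c∈S) e∣c e≢c) ⟩
  recip e                    ≡⟨ ℚ.+-identityʳ (recip e) ⟨
  recip e + 0ℚ               ∎)
  where
  open ℚ.≤-Reasoning
  pos = FinPosSet.positive fin

-- Choosing an element of a list along chains

-- The divisors of a number within the chain `A` form an initial segment of `A`. Such segments are
-- nested, so a list entry with the smallest segment has it contained in the segments of all the
-- others.
fewest-divisors : IsChain A → ∀ c cs →
  ∃[ g ] g ∈ c ∷ cs × (∀ {a} → a ∈ A → a ∣ g → ∀ {d} → d ∈ c ∷ cs → a ∣ d)
fewest-divisors chain c [] = c , here refl , λ { _ a∣c (here refl) → a∣c }
fewest-divisors {A} chain c (b ∷ cs) with fewest-divisors chain b cs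
... | g , g∈ , g-min with any? (λ a → (a ∣? g) ×-dec ¬? (a ∣? c)) A
...   | no none = g , there g∈ , min
  where
  min : ∀ {a} → a ∈ A → a ∣ g → ∀ {d} → d ∈ c ∷ b ∷ cs → a ∣ d
  min {a} a∈A a∣g (there d∈) = g-min a∈A a∣g d∈
  min {a} a∈A a∣g (here refl) with a ∣? c
  ... | yes a∣c = a∣c
  ... | no a∤c  = contradiction (lose a∈A (a∣g , a∤c)) none
...   | yes some = c , here refl , min
  where
  min : ∀ {a} → a ∈ A → a ∣ c → ∀ {d} → d ∈ c ∷ b ∷ cs → a ∣ d
  min a∈A a∣c (here refl) = a∣c
  min a∈A a∣c (there d∈) with find some
  -- Here `a₀` separates `g` from `c`: an element of the chain dividing `c` cannot lie above `a₀`,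
  -- so it divides `a₀` and hence `g`.
  ... | a₀ , a₀∈A , a₀∣g , a₀∤c with chain a∈A a₀∈A
  ...   | inj₁ a∣a₀ = g-min a∈A (∣-trans a∣a₀ a₀∣g) d∈
  ...   | inj₂ a₀∣a = contradiction (∣-trans a₀∣a a∣c) a₀∤c

∣-maximum : (f : ℕ → ℕ) → ∀ c cs → (∀ {d e} → d ∈ c ∷ cs → e ∈ c ∷ cs → f d ∣ f e ⊎ f e ∣ f d) →
  ∃[ m ] m ∈ c ∷ cs × (∀ {d} → d ∈ c ∷ cs → f d ∣ f m)
∣-maximum f c []       total = c , here refl , λ { (here refl) → ∣-refl }
∣-maximum f c (b ∷ cs) total with ∣-maximum f b cs (λ d∈ e∈ → total (there d∈) (there e∈))
... | m , m∈ , m-max with total {c} {m} (here refl) (there m∈)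
...   | inj₁ fc∣fm = m , there m∈ , λ { (here refl) → fc∣fm ; (there d∈) → m-max d∈ }
...   | inj₂ fm∣fc = c , here refl , λ { (here refl) → ∣-refl ; (there d∈) → ∣-trans (m-max d∈) fm∣fc }

∈⇒↭ : {c : X} {cs : List X} → c ∈ cs → ∃[ ds ] cs ↭ c ∷ ds
∈⇒↭ {c = c} c∈cs with ∈-∃++ c∈cs
... | ys , zs , refl = ys ++ zs , shift c ys zs

-- Covered elements

module _ (S : List ℕ) (x : ℕ) where

  Between : ℕ → ℕ → Set
  Between y z = y ∣ z × z ∣ x × ¬ z ≡ y × ¬ z ≡ x

  between? : ∀ y → Decidable (Between y)
  between? y z = (y ∣? z) ×-dec ((z ∣? x) ×-dec (¬? (z ℕ.≟ y) ×-dec ¬? (z ℕ.≟ x)))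

  -- A decidable counterpart of `Covered`: the condition on all elements of `S` becomes a failed
  -- search for one strictly between `y` and `x`, so the covered elements can be filtered out of
  -- `S`.
  covered? : Decidable (λ y → y ∣ x × ¬ y ≡ x × ¬ Any (Between y) S)
  covered? y = (y ∣? x) ×-dec (¬? (y ℕ.≟ x) ×-dec ¬? (any? (between? y) S))

  covers : List ℕ
  covers = filter covered? S

  ∈-covers⁻ : ∀ {y} → y ∈ covers → Covered S x y
  ∈-covers⁻ {y} y∈ with ∈-filter⁻ covered? {xs = S} y∈
  ... | y∈S , y∣x , y≢x , none = y∈S , y∣x , y≢x , extremal
    where
    extremal : ∀ z → z ∈ S → y ∣ z → z ∣ x → z ≡ y ⊎ z ≡ x
    extremal z z∈S y∣z z∣x with z ℕ.≟ y | z ℕ.≟ x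
    ... | yes z≡y | _       = inj₁ z≡y
    ... | no _    | yes z≡x = inj₂ z≡x
    ... | no z≢y  | no z≢x  = contradiction (lose z∈S (y∣z , z∣x , z≢y , z≢x)) none

  -- Climbs from `y`: either `y` is itself covered by `x`, or some element of `S` lies strictly
  -- between and takes its place. The number `n` bounds the distance left to `x`, which shrinks at
  -- each step.
  covers-cofinal : All (0 <_) S → 0 < x → ∀ n {y} → y ∈ S → y ∣ x → y ≢ x → x ≤ n ℕ.+ y → Any (y ∣_) covers
  covers-cofinal pos 0<x zero y∈S y∣x y≢x x≤y =
    contradiction (∣∧≢⇒< 0<x y∣x y≢x) (ℕ.≤⇒≯ x≤y)
  covers-cofinal pos 0<x (suc n) {y} y∈S y∣x y≢x x≤n+y with any? (between? y) S
  ... | no none  = lose (∈-filter⁺ covered? y∈S (y∣x , y≢x , none)) ∣-refl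
  ... | yes some with find some
  ...   | z , z∈S , y∣z , z∣x , z≢y , z≢x =
    Any.map (∣-trans y∣z) (covers-cofinal pos 0<x n z∈S z∣x z≢x (begin
      x             ≤⟨ x≤n+y ⟩
      suc n ℕ.+ y   ≡⟨ ℕ.+-suc n y ⟨
      n ℕ.+ suc y   ≤⟨ ℕ.+-monoʳ-≤ n (∣∧≢⇒< (All.lookup pos z∈S) y∣z (z≢y ∘ sym)) ⟩
      n ℕ.+ z       ∎))
    where
    open ℕ.≤-Reasoning

-- Gcds of covered elements and signs of `T`

module _ {S : List ℕ} (fin : FinPosSet S) (closed : GCDClosed S) {x : ℕ} where

  private
    pos = FinPosSet.positive fin

  -- By `covers-cofinal` every divisor of `x` in `S` other than `x` divides a covered element, while
  -- `x` divides none, so only the summand at `x` survives.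
  T-covers : x ∈ S → T S x (covers S x) ≡ Ψ S x
  T-covers x∈S = trans
    (∑-cong S (λ {z} z∈S → on-cong (divides∌? x (covers S x) z) (z ℕ.≟ x) (maximal z∈S)
      (λ { refl → ∣-refl , x∤covers }) (λ _ → refl)))
    (∑-single (FinPosSet.distinct fin) x∈S (Ψ S))
    where
    x∤covers : ¬ Any (x ∣_) (covers S x)
    x∤covers x∣cs with find x∣cs
    ... | c , c∈ , x∣c with ∈-covers⁻ S x c∈
    ...   | _ , c∣x , c≢x , _ = c≢x (∣-antisym c∣x x∣c)
    maximal : ∀ {z} → z ∈ S → Divides∌ x (covers S x) z → z ≡ x
    maximal {z} z∈S (z∣x , z∤cs) with z ℕ.≟ x
    ... | yes z≡x = z≡x
    ... | no z≢x  = contradiction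
      (covers-cofinal S x pos (All.lookup pos x∈S) x z∈S z∣x z≢x (ℕ.m≤m+n x z)) z∤cs

  -- Otherwise `c` would divide `d`, placing `d` between `c` and `x`, and covering would force `d`
  -- to be one of the two.
  gcd≢ˡ : ∀ {c d} → Covered S x c → Covered S x d → c ≢ d → gcd c d ≢ c
  gcd≢ˡ {c} {d} (_ , _ , c≢x , extremal) (d∈S , d∣x , d≢x , _) c≢d gcd≡c
    with extremal d d∈S (subst (_∣ d) gcd≡c (gcd[m,n]∣n c d)) d∣x
  ... | inj₁ d≡c = c≢d (sym d≡c)
  ... | inj₂ d≡x = d≢x d≡x

  gcd≢ʳ : ∀ {c d} → Covered S x c → Covered S x d → c ≢ d → gcd c d ≢ d
  gcd≢ʳ {c} {d} c◁x d◁x c≢d gcd≡d = gcd≢ˡ d◁x c◁x (c≢d ∘ sym) (trans (gcd-comm d c) gcd≡d)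

  -- The element `c` lies strictly between the gcd and `x`. This places the gcd in the set that the
  -- two chains describe.
  gcd-notCovered : ∀ {c d} → Covered S x c → Covered S x d → c ≢ d → ¬ Covered S x (gcd c d)
  gcd-notCovered {c} {d} c◁x@(c∈S , c∣x , c≢x , _) d◁x c≢d (_ , _ , _ , extremal)
    with extremal c c∈S (gcd[m,n]∣m c d) c∣x
  ... | inj₁ c≡gcd = gcd≢ˡ c◁x d◁x c≢d (sym c≡gcd)
  ... | inj₂ c≡x   = c≢x c≡x

  -- Inclusion-exclusion gives 1/x + 1/e = 1/c + 1/d + T with e = gcd(c,d). As 1/c + 1/d is at most
  -- 1/e, strictness comes from 1/x > 0.
  T-pair : x ∈ S → ∀ {c d} → Covered S x c → Covered S x d → c ≢ d → 0ℚ ℚ.< T S x (c ∷ d ∷ [])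
  T-pair x∈S {c} {d} c◁x@(c∈S , c∣x , _) d◁x@(d∈S , d∣x , _) c≢d =
    +-cancelˡ-< (recip c + recip d) (begin-strict
      recip c + recip d + 0ℚ                      ≡⟨ ℚ.+-identityʳ (recip c + recip d) ⟩
      recip c + recip d                           ≤⟨ recip-+-≤ (All.lookup pos e∈S) e∣c e<c e∣d e<d ⟩
      recip e                                     ≡⟨ ℚ.+-identityˡ (recip e) ⟨
      0ℚ + recip e                                <⟨ ℚ.+-monoˡ-< (recip e) (0<recip (All.lookup pos x∈S)) ⟩
      recip x + recip e                           ≡⟨ inclusion-exclusion ⟩
      recip c + recip d + T S x (c ∷ d ∷ [])      ∎)
    where
    e = gcd c d
    e∈S = closed c∈S d∈S
    e∣c = gcd[m,n]∣m c d
    e∣d = gcd[m,n]∣n c d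
    e<c = ∣∧≢⇒< (All.lookup pos c∈S) e∣c (gcd≢ˡ c◁x d◁x c≢d)
    e<d = ∣∧≢⇒< (All.lookup pos d∈S) e∣d (gcd≢ʳ c◁x d◁x c≢d)
    T-c-d : T S c (d ∷ []) ≡ T S c (e ∷ [])
    T-c-d = T-dominated S (here refl) λ { (here refl) → ∣-refl }
    open ℚ.≤-Reasoning
    inclusion-exclusion : recip x + recip e ≡ recip c + recip d + T S x (c ∷ d ∷ [])
    inclusion-exclusion = begin-equality
      recip x + recip e
        ≡⟨ cong (_+ recip e) (T-singleton fin x∈S d∈S d∣x) ⟩
      recip d + T S x (d ∷ []) + recip e
        ≡⟨ cong (λ t → recip d + t + recip e) (trans (T-split S (d ∷ []) c∣x) (cong (_+ t) T-c-d)) ⟩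
      recip d + (u + t) + recip e
        ≡⟨ solve 4 (λ D U T E → D :+ (U :+ T) :+ E := E :+ U :+ D :+ T) refl (recip d) u t (recip e) ⟩
      recip e + u + recip d + t
        ≡⟨ cong (λ r → r + recip d + t) (T-singleton fin c∈S e∈S e∣c) ⟨
      recip c + recip d + t ∎
      where
      open ℚ-Solver
      u = T S c (e ∷ [])
      t = T S x (c ∷ d ∷ [])

  -- Adding `c` to the list removes the summand `T S c cs`, which is negative by `T-dominated` and
  -- `T<0`, so the sum grows.
  T-step : ∀ {c cs m} → Covered S x c → m ∈ cs → Covered S x m → c ≢ m →
    (∀ {d} → d ∈ cs → gcd c d ∣ gcd c m) → 0ℚ ℚ.< T S x cs → 0ℚ ℚ.< T S x (c ∷ cs)
  T-step {c} {cs} {m} c◁x@(c∈S , c∣x , _) m∈cs m◁x@(m∈S , _) c≢m dominated 0<T = begin-strict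
    0ℚ                                   <⟨ 0<T ⟩
    T S x cs                             ≡⟨ T-split S cs c∣x ⟩
    T S c cs + T S x (c ∷ cs)            ≡⟨ cong (_+ T S x (c ∷ cs)) (T-dominated S m∈cs dominated) ⟩
    T S c (gcd c m ∷ []) + T S x (c ∷ cs)
      <⟨ ℚ.+-monoˡ-< (T S x (c ∷ cs))
           (T<0 fin c∈S (closed c∈S m∈S) (gcd[m,n]∣m c m) (gcd≢ˡ c◁x m◁x c≢m)) ⟩
    0ℚ + T S x (c ∷ cs)                  ≡⟨ ℚ.+-identityˡ (T S x (c ∷ cs)) ⟩
    T S x (c ∷ cs)                       ∎
    where open ℚ.≤-Reasoning

  -- Positivity when the gcds lie in two chains

  module _ (x∈S : x ∈ S) (chainA : IsChain A) (chainB : IsChain B)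
    (gcd∈ : ∀ {c d} → Covered S x c → Covered S x d → c ≢ d → gcd c d ∈ A ⊎ gcd c d ∈ B) where

    -- The induction is on the length, since the entry removed at each step is picked from anywhere
    -- in the list and the remainder is known only up to permutation.
    T-positive : ∀ n cs → length cs ≡ suc (suc n) → Unique cs → (∀ {c} → c ∈ cs → Covered S x c) →
      0ℚ ℚ.< T S x cs
    T-positive zero (c ∷ d ∷ []) _ ((c≢d ∷ _) ∷ _) cs◁x =
      T-pair x∈S (cs◁x (here refl)) (cs◁x (there (here refl))) c≢d
    T-positive (suc n) cs@(b ∷ bs) len uniq cs◁x
      with c , c∈cs , c-min ← fewest-divisors chainA b bs
      with ∈⇒↭ c∈cs
    ... | [] , cs↭[c] = contradiction (trans (sym len) (↭-length cs↭[c])) λ ()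
    ... | ds@(e ∷ es) , cs↭c∷ds
      with c∉ds ∷ uniq-ds ← Unique-resp-↭ (setoid ℕ) (↭⇒↭ₛ cs↭c∷ds) uniq
      = subst (0ℚ ℚ.<_) (T-↭ S (↭-sym cs↭c∷ds)) (step (∣-maximum (gcd c) e es comparable))
      where
      ds⊆cs : ∀ {d} → d ∈ ds → d ∈ cs
      ds⊆cs d∈ds = ∈-resp-↭ (↭-sym cs↭c∷ds) (there d∈ds)
      c◁x : Covered S x c
      c◁x = cs◁x c∈cs
      comparable : ∀ {d f} → d ∈ ds → f ∈ ds → gcd c d ∣ gcd c f ⊎ gcd c f ∣ gcd c d
      comparable {d} {f} d∈ f∈
        with gcd∈ c◁x (cs◁x (ds⊆cs d∈)) (All.lookup c∉ds d∈)
           | gcd∈ c◁x (cs◁x (ds⊆cs f∈)) (All.lookup c∉ds f∈)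
      -- A gcd in `A` divides `c`, so by the choice of `c` it divides every entry of the list, in
      -- particular the other one, and thus the other gcd.
      ... | inj₁ d∈A | _ = inj₁ (gcd-greatest (gcd[m,n]∣m c d) (c-min d∈A (gcd[m,n]∣m c d) (ds⊆cs f∈)))
      ... | inj₂ _ | inj₁ f∈A = inj₂ (gcd-greatest (gcd[m,n]∣m c f) (c-min f∈A (gcd[m,n]∣m c f) (ds⊆cs d∈)))
      ... | inj₂ d∈B | inj₂ f∈B = chainB d∈B f∈B
      step : ∃[ m ] m ∈ ds × (∀ {d} → d ∈ ds → gcd c d ∣ gcd c m) → 0ℚ ℚ.< T S x (c ∷ ds)
      step (m , m∈ds , dominated) = T-step c◁x m∈ds (cs◁x (ds⊆cs m∈ds)) (All.lookup c∉ds m∈ds) dominated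
        (T-positive n ds (ℕ.suc-injective (trans (sym (↭-length cs↭c∷ds)) len)) uniq-ds (cs◁x ∘ ds⊆cs))

    -- The sign depends on the length: the empty list gives 1/x > 0, a single covered element a
    -- negative value, and longer lists a positive one.
    T≢0 : ∀ cs → Unique cs → (∀ {c} → c ∈ cs → Covered S x c) → T S x cs ≢ 0ℚ
    T≢0 [] _ _ T≡0 = ℚ.<-irrefl (trans (sym T≡0) (T-[] fin x∈S)) (0<recip (All.lookup pos x∈S))
    T≢0 (c ∷ []) _ cs◁x T≡0 with cs◁x (here refl)
    ... | c∈S , c∣x , c≢x , _ = ℚ.<-irrefl T≡0 (T<0 fin x∈S c∈S c∣x c≢x)
    T≢0 cs@(_ ∷ _ ∷ _) uniq cs◁x T≡0 = ℚ.<-irrefl (sym T≡0) (T-positive _ cs refl uniq cs◁x)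

theorem4p2 : (S : List ℕ) → FinPosSet S → GCDClosed S →
    (x : ℕ) → x ∈ S → DoubleChain S x → Ψ S x ≢ 0ℚ
theorem4p2 S fin closed x x∈S (A , B , chainA , chainB , _ , meets) Ψ≡0 =
  T≢0 fin closed x∈S chainA chainB gcd∈ (covers S x)
    (filter⁺ (covered? S x) (FinPosSet.distinct fin)) (∈-covers⁻ S x)
    (trans (T-covers fin closed x∈S) Ψ≡0)
  where
  gcd∈ : ∀ {c d} → Covered S x c → Covered S x d → c ≢ d → gcd c d ∈ A ⊎ gcd c d ∈ B
  -- The two-element list of `c` and `d` witnesses that their gcd belongs to the meet closure.
  gcd∈ {c} {d} c◁x d◁x c≢d = Equivalence.to (meets (gcd c d))
    (((c ∷ d ∷ []) , c◁x ∷ d◁x ∷ [] , refl) , gcd-notCovered fin closed c◁x d◁x c≢d)
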